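{- The logics $\mathrm{FO}[\mathrm{arb}]$ and $\mathrm{FO}[\leq, \mathrm{MSB}_0, \mathrm{fin}]$ define the same languages. That is, for every finite alphabet $A$ and every language $L \subseteq A^*$, $L$ is defined by a sentence of $\mathrm{FO}[\mathrm{arb}]$ if and only if $L$ is defined by a sentence of $\mathrm{FO}[\leq, \mathrm{MSB}_0, \mathrm{fin}]$.
   Context: Notation: $\mathbb{N} = \{0,1,2,\ldots\}$ and $[n] = \{0,1,\ldots,n-1\}$. Logic on words: for a finite alphabet $A$, let $\sigma_A = \{\mathbf{a} \mid a \in A\}$ be a vocabulary of unary letter predicates. A word $u = u_0u_1\cdots u_{n-1} \in A^*$ is identified with the structure with universe $[n]$ in which $\mathbf{a}$ is interpreted as the set of positions $i$ with $u_i = a$. A numerical predicate is a $k$-ary relation symbol together with, for each universe size $n$, an interpretation which is a subset of $[n]^k$ (depending on $n$ in an arbitrary way). For a formula $\phi$ using numerical predicates, $u \models \phi$ means that $\phi$ is true in the structure of $u$ augmented with the interpretations of the numerical predicates for universe size $|u|$. A sentence $\phi$ defines the language $\{u \in A^* \mid u \models \phi\}$. $\mathrm{arb}$ is the set of all numerical predicates. For a set $\mathcal{N}$ of numerical predicates, $\mathrm{FO}[\mathcal{N}]$ is the set of first-order formulas built using the symbols of $\mathcal{N} \cup \sigma_A$, for any alphabet $A$. In $\mathrm{FO}[\leq,\mathrm{MSB}_0,\mathrm{fin}]$ the allowed numerical predicates are $\leq$, $\mathrm{MSB}_0$, and all the predicates in $\mathrm{fin}$. A $k$-ary numerical predicate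 $P$ is unvaried if there is a set $E \subseteq \mathbb{N}^k$ such that the interpretation of $P$ on universes of size $n$ is $E \cap [n]^k$ for every $n$; then $P$ is identified with $E$. The order $\leq$ is the usual unvaried binary predicate. $\mathrm{MSB}_0$ is the unvaried binary predicate that zeroes the most significant bit: $(m,n) \in \mathrm{MSB}_0$ iff $n = m - 2^{\lfloor \log_2 m\rfloor}$. An unvaried predicate $P \subseteq \mathbb{N}^k$ is of finite degree if every $n \in \mathbb{N}$ appears in only finitely many tuples of $P$; $\mathrm{fin}$ is the class of all (unvaried) finite-degree predicates (of all arities). -}

module Defs where

open import Data.Fin using (Fin; toℕ)
open import Data.List using (List; length; lookup)
open import Data.List.Membership.Propositional using () renaming (_∈_ to _∈ˡ_)
open import Data.Nat using (ℕ; suc; _∸_; _^_; _≤_)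
open import Data.Nat.Logarithm using (⌊log₂_⌋)
open import Data.Product using (∃; _×_)
open import Data.Sum using (_⊎_)
open import Data.Vec using (Vec; []; _∷_)
import Data.Vec as Vec
open import Data.Vec.Membership.Propositional using (_∈_)
open import Level using (0ℓ) renaming (suc to lsuc)
open import Relation.Binary.PropositionalEquality using (_≡_; _≢_)
open import Relation.Nullary using (¬_)
open import Relation.Unary using (Pred; _≐_)
import Relation.Unary.Polymorphic as Polymorphic

-- The interpretation of a k-ary predicate on each universe [n].
NumericalPredicate : ℕ → Set₁
NumericalPredicate k = ∀ n → Pred (Vec (Fin n) k) 0ℓ

unvaried : ∀ {k} → Pred (Vec ℕ k) 0ℓ → NumericalPredicate k
unvaried E n xs = E (Vec.map toℕ xs)

Leq : Pred (Vec ℕ 2) 0ℓ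
Leq (m ∷ n ∷ []) = m ≤ n

-- The logarithm of 0 is undefined, so MSB₀ contains no pair (0 , n);
-- the guard is needed because the library sets ⌊log₂ 0 ⌋ = 0.
MSB₀ : Pred (Vec ℕ 2) 0ℓ
MSB₀ (m ∷ n ∷ []) = m ≢ 0 × n ≡ m ∸ 2 ^ ⌊log₂ m ⌋

-- Each n occurs in only finitely many tuples: some list contains all of
-- them (and possibly other tuples, which avoids deciding E).
FiniteDegree : ∀ {k} → Pred (Vec ℕ k) 0ℓ → Set
FiniteDegree {k} E =
  ∀ n → ∃ λ (ts : List (Vec ℕ k)) → ∀ t → E t → n ∈ t → t ∈ˡ ts

-- Sets 𝒩 of numerical predicates of all arities.
NumericalClass : Set₂
NumericalClass = ∀ k → Pred (NumericalPredicate k) (lsuc 0ℓ)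

arb : NumericalClass
arb k = Polymorphic.U

data fin : NumericalClass where
  finiteDegree : ∀ {k} {E : Pred (Vec ℕ k) 0ℓ} →
                 FiniteDegree E → fin k (unvaried E)

data ≤-MSB₀-fin : NumericalClass where
  leq  : ≤-MSB₀-fin 2 (unvaried Leq)
  msb₀ : ≤-MSB₀-fin 2 (unvaried MSB₀)
  fin⊆ : ∀ {k} {P : NumericalPredicate k} → fin k P → ≤-MSB₀-fin k P

infix  8 _≈′_
infixr 7 _∧′_
infixr 6 _∨′_
infixr 5 _⇒′_

-- FO[𝒩] formulas over A with free variables among v de Bruijn indices.
data FO (𝒩 : NumericalClass) (A : Set) (v : ℕ) : Set₁ where
  letter         : A → Fin v → FO 𝒩 A v
  num            : ∀ {k} (P : NumericalPredicate k) → 𝒩 k P →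
                   Vec (Fin v) k → FO 𝒩 A v
  _≈′_           : Fin v → Fin v → FO 𝒩 A v
  ¬′_            : FO 𝒩 A v → FO 𝒩 A v
  _∧′_ _∨′_ _⇒′_ : FO 𝒩 A v → FO 𝒩 A v → FO 𝒩 A v
  ∃′_ ∀′_        : FO 𝒩 A (suc v) → FO 𝒩 A v

Sentence : NumericalClass → Set → Set₁
Sentence 𝒩 A = FO 𝒩 A 0

infix 4 _,_⊨_

_,_⊨_ : ∀ {𝒩 A v} (u : List A) → Vec (Fin (length u)) v → FO 𝒩 A v → Set
u , ρ ⊨ letter a x = lookup u (Vec.lookup ρ x) ≡ a
u , ρ ⊨ num P _ xs = P (length u) (Vec.map (Vec.lookup ρ) xs)
u , ρ ⊨ (x ≈′ y)   = Vec.lookup ρ x ≡ Vec.lookup ρ y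
u , ρ ⊨ (¬′ φ)     = ¬ (u , ρ ⊨ φ)
u , ρ ⊨ (φ ∧′ ψ)   = (u , ρ ⊨ φ) × (u , ρ ⊨ ψ)
u , ρ ⊨ (φ ∨′ ψ)   = (u , ρ ⊨ φ) ⊎ (u , ρ ⊨ ψ)
u , ρ ⊨ (φ ⇒′ ψ)   = (u , ρ ⊨ φ) → (u , ρ ⊨ ψ)
u , ρ ⊨ (∃′ φ)     = ∃ λ i → u , i ∷ ρ ⊨ φ
u , ρ ⊨ (∀′ φ)     = ∀ i → u , i ∷ ρ ⊨ φ

Language : Set → Set₁
Language A = Pred (List A) 0ℓ

language : ∀ {𝒩 A} → Sentence 𝒩 A → Language A
language φ u = u , [] ⊨ φ

DefinableIn : NumericalClass → ∀ {A} → Language A → Set₁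
DefinableIn 𝒩 {A} L = ∃ λ (φ : Sentence 𝒩 A) → L ≐ language φ

{-# OPTIONS --safe #-}
-- In a non-empty universe [n] with greatest element N, every x either
-- satisfies N ≤ 4x or has a preimage y ≤ N under MSB₀ with N ≤ 4y: when 4x < N
-- and 2^i ≤ N < 2^(i+1), take y = x + 2^(i-1) (and y = 1 if i = 0).  So an atom
-- P(x₁,…,x_k) can be replaced by an atom on N and large elements y₁,…,y_k from
-- which the xⱼ are recovered.  Entries of such a tuple bound N, hence all the
-- other entries, up to a factor 4, so the new predicate has finite degree; and
-- it is unvaried because N determines n.
module Submission where

open import Defs
open import Data.Fin using (Fin; zero; suc; toℕ; fromℕ; fromℕ<)
open import Data.Fin.Properties using (toℕ-fromℕ; toℕ-fromℕ<; toℕ-injective; toℕ<n; toℕ≤pred[n])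
open import Data.List using (List; []; _∷_; length; upTo; cartesianProductWith)
open import Data.List.Membership.Propositional using () renaming (_∈_ to _∈ˡ_)
open import Data.List.Membership.Propositional.Properties using (∈-cartesianProductWith⁺; ∈-upTo⁺)
open import Data.List.Relation.Unary.Any using (here)
open import Data.Nat using (ℕ; zero; suc; _+_; _*_; _∸_; _^_; _≤_; _<_; _≤?_; _<?_; ⌊_/2⌋; z≤n; s≤s; s≤s⁻¹)
open import Data.Nat.Logarithm using (⌊log₂_⌋; ⌊log₂⌋-mono-≤; ⌊log₂⌊n/2⌋⌋≡⌊log₂n⌋∸1; ⌊log₂[2^n]⌋≡n)
open import Data.Nat.Properties
open import Data.Product using (∃; _×_; _,_; proj₂)
open import Data.Product.Function.Dependent.Propositional using (Σ-⇔)
open import Data.Product.Function.NonDependent.Propositional using (_×-⇔_)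
open import Data.Sum using (_⊎_; inj₁; inj₂)
open import Data.Sum.Function.Propositional using (_⊎-⇔_)
open import Data.Unit.Polymorphic using (tt)
open import Data.Vec using (Vec; []; _∷_; lookup; map)
open import Data.Vec.Membership.Propositional using (_∈_)
open import Data.Vec.Properties using (map-∘; ∷-injective)
open import Data.Vec.Relation.Unary.All as All using (All; []; _∷_)
open import Data.Vec.Relation.Unary.All.Properties using (map⁺)
open import Data.Vec.Relation.Unary.Any using (here; there)
open import Function using (_∘_)
open import Function.Bundles using (_↔_; _⇔_; mk⇔; module Equivalence)
open import Function.Construct.Identity using (⇔-id; ↠-id)
open import Function.Related.TypeIsomorphisms using (→-cong-⇔; ¬-cong-⇔)
open import Level using (0ℓ)
open import Relation.Binary.PropositionalEquality using (_≡_; _≢_; refl; sym; trans; cong; cong₂; subst; subst₂)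
open import Relation.Nullary using (¬_; yes; no; contradiction)
open import Relation.Unary using (Pred)

open Equivalence using (to; from)

2*⌊n/2⌋≤n : ∀ n → 2 * ⌊ n /2⌋ ≤ n
2*⌊n/2⌋≤n n = begin
  2 * ⌊ n /2⌋            ≡⟨ cong (⌊ n /2⌋ +_) (+-identityʳ _) ⟩
  ⌊ n /2⌋ + ⌊ n /2⌋      ≤⟨ +-monoʳ-≤ ⌊ n /2⌋ (⌊n/2⌋≤⌈n/2⌉ n) ⟩
  ⌊ n /2⌋ + _            ≡⟨ ⌊n/2⌋+⌈n/2⌉≡n n ⟩
  n                      ∎
  where open ≤-Reasoning

-- Induction on `j`: halving `y` takes one off the exponent and, with truncated subtraction, one off
-- the logarithm.
⌊log₂⌋-upper : ∀ j {y} → y < 2 ^ suc j → ⌊log₂ y ⌋ ≤ j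
⌊log₂⌋-upper zero    y<2 = ⌊log₂⌋-mono-≤ (s≤s⁻¹ y<2)
⌊log₂⌋-upper (suc j) {y} y<2^ = bound
  where
  half : ⌊ y /2⌋ < 2 ^ suc j
  half = *-cancelˡ-< 2 _ _ (≤-<-trans (2*⌊n/2⌋≤n y) y<2^)
  bound : ⌊log₂ y ⌋ ≤ suc j
  bound = ≤-trans (m≤n+m∸n ⌊log₂ y ⌋ 1)
    (s≤s (subst (_≤ j) (⌊log₂⌊n/2⌋⌋≡⌊log₂n⌋∸1 y) (⌊log₂⌋-upper j half)))

⌊log₂⌋-unique : ∀ j {y} → 2 ^ j ≤ y → y < 2 ^ suc j → ⌊log₂ y ⌋ ≡ j
⌊log₂⌋-unique j 2^j≤y y<2^ = ≤-antisym (⌊log₂⌋-upper j y<2^)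
  (subst (_≤ _) (⌊log₂[2^n]⌋≡n j) (⌊log₂⌋-mono-≤ 2^j≤y))

2^m+2^m≡2^[1+m] : ∀ j → 2 ^ j + 2 ^ j ≡ 2 ^ suc j
2^m+2^m≡2^[1+m] j = cong (2 ^ j +_) (sym (+-identityʳ _))

dyadic-bracket : ∀ n → ∃ λ i → 2 ^ i ≤ suc n × suc n < 2 ^ suc i
dyadic-bracket zero = 0 , ≤-refl , ≤-refl
dyadic-bracket (suc n) with dyadic-bracket n
... | i , lo , hi with suc (suc n) <? 2 ^ suc i
...   | yes hi′ = i , m≤n⇒m≤1+n lo , hi′
...   | no ¬hi′ = suc i , ≮⇒≥ ¬hi′ , ≤-<-trans hi (^-monoʳ-< 2 ≤-refl (n<1+n (suc i)))

-- As `x` lies below `2 ^ j`, the addition does not carry: `2 ^ j` is the leading bit of the sum,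
-- and zeroing it returns `x`.
MSB₀-+2^ : ∀ j {x} → x < 2 ^ j → MSB₀ (x + 2 ^ j ∷ x ∷ [])
MSB₀-+2^ j {x} x<2^j = nonzero , sym (trans (cong (λ i → x + 2 ^ j ∸ 2 ^ i) log) (m+n∸n≡m x (2 ^ j)))
  where
  nonzero : x + 2 ^ j ≢ 0
  nonzero = >⇒≢ (<-≤-trans (m^n>0 2 j) (m≤n+m _ x))
  log : ⌊log₂ x + 2 ^ j ⌋ ≡ j
  log = ⌊log₂⌋-unique j (m≤n+m _ x)
    (<-≤-trans (+-monoˡ-< (2 ^ j) x<2^j) (≤-reflexive (2^m+2^m≡2^[1+m] j)))

MSB₀-preimage : ∀ {N x} → 4 * x < N → ∃ λ y → y ≤ N × N ≤ 4 * y × MSB₀ (y ∷ x ∷ [])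
MSB₀-preimage {suc N} {x} 4x<N with dyadic-bracket N
... | zero  , lo , hi = x + 1 , ≤-trans (≤-reflexive (cong (_+ 1) x≡0)) (s≤s z≤n)
                      , ≤-trans (<⇒≤ hi) (≤-trans (s≤s (s≤s z≤n)) (*-monoʳ-≤ 4 (m≤n+m 1 x)))
                      , MSB₀-+2^ 0 (≤-reflexive (cong suc x≡0))
  where
  x≡0 : x ≡ 0
  x≡0 = n<1⇒n≡0 (*-cancelˡ-< 4 x 1 (<-trans 4x<N (<-≤-trans hi (s≤s (s≤s z≤n)))))
-- From `4 * x < suc N < 4 * 2 ^ j` follows `x < 2 ^ j`, so the witness is at most
-- `2 ^ suc j ≤ suc N`; its summand `2 ^ j` alone makes it large.
... | suc j , lo , hi = x + 2 ^ j
                      , ≤-trans (+-monoˡ-≤ (2 ^ j) (<⇒≤ x<2^j)) (≤-trans (≤-reflexive (2^m+2^m≡2^[1+m] j)) lo)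
                      , ≤-trans (<⇒≤ N<4*2^j) (*-monoʳ-≤ 4 (m≤n+m (2 ^ j) x))
                      , MSB₀-+2^ j x<2^j
  where
  N<4*2^j : suc N < 4 * 2 ^ j
  N<4*2^j = <-≤-trans hi (≤-reflexive (sym (*-assoc 2 2 (2 ^ j))))
  x<2^j : x < 2 ^ j
  x<2^j = *-cancelˡ-< 4 _ _ (<-trans 4x<N N<4*2^j)

-- For the greatest element N = n - 1 of [n], this says N ≤ 4y.
Large : ℕ → ℕ → Set
Large n y = n ≤ suc (4 * y)

large-or-MSB₀ : ∀ {n} (x : Fin n) →
  Large n (toℕ x) ⊎ ∃ λ (y : Fin n) → Large n (toℕ y) × MSB₀ (toℕ y ∷ toℕ x ∷ [])
large-or-MSB₀ {suc N} x with N ≤? 4 * toℕ x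
... | yes N≤4x = inj₁ (s≤s N≤4x)
... | no  N≰4x with MSB₀-preimage (≰⇒> N≰4x)
...   | y , y≤N , N≤4y , msb = inj₂ (fromℕ< (s≤s y≤N)
        , subst (λ z → Large (suc N) z × MSB₀ (z ∷ toℕ x ∷ [])) (sym (toℕ-fromℕ< (s≤s y≤N))) (s≤s N≤4y , msb))

tuples : ∀ {X : Set} → List X → ∀ k → List (Vec X k)
tuples xs zero    = [] ∷ []
tuples xs (suc k) = cartesianProductWith _∷_ xs (tuples xs k)

∈-tuples : ∀ {X : Set} {xs : List X} {k} {t : Vec X k} → All (_∈ˡ xs) t → t ∈ˡ tuples xs k
∈-tuples []       = here refl
∈-tuples (p ∷ ps) = ∈-cartesianProductWith⁺ _∷_ p (∈-tuples ps)

-- The size `n` is a variable tied to `N` by an equation, so that a universe whose size is only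
-- propositionally `suc N` can supply its own tuple without transport.
Guarded : ∀ {m} → NumericalPredicate m → Pred (Vec ℕ (suc m)) 0ℓ
Guarded {m} Q (N ∷ ys) = ∃ λ n → suc N ≡ n × ∃ λ (zs : Vec (Fin n) m) →
  map toℕ zs ≡ ys × All (Large n) ys × Q n zs

-- Whether `a` is `N` itself or a large entry, `N ≤ 4 * a`; all entries are at most `N`, so the
-- tuple lies in a finite cube.
guarded-finiteDegree : ∀ {m} (Q : NumericalPredicate m) → FiniteDegree (Guarded Q)
guarded-finiteDegree {m} Q a = tuples (upTo (suc (4 * a))) (suc m) , λ where
    (N ∷ _) (_ , refl , zs , refl , large , _) a∈ →
      let N≤4a = bound large a∈ in
      ∈-tuples (∈-upTo⁺ (s≤s N≤4a) ∷
        map⁺ (All.universal (λ z → ∈-upTo⁺ (≤-trans (toℕ<n z) (s≤s N≤4a))) zs))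
  where
  bound : ∀ {N} {ys : Vec ℕ m} → All (Large (suc N)) ys → a ∈ N ∷ ys → N ≤ 4 * a
  bound large (here refl) = m≤n*m a 4
  bound large (there a∈)  = s≤s⁻¹ (All.lookup large a∈)

map-toℕ-injective : ∀ {n m} {xs ys : Vec (Fin n) m} → map toℕ xs ≡ map toℕ ys → xs ≡ ys
map-toℕ-injective {xs = []}     {[]}     _  = refl
map-toℕ-injective {xs = x ∷ xs} {y ∷ ys} eq with ∷-injective eq
... | x≡y , xs≡ys = cong₂ _∷_ (toℕ-injective x≡y) (map-toℕ-injective xs≡ys)

-- The greatest element pins the hidden size `n′` to `n`, and then injectivity of `toℕ` identifies
-- the hidden tuple with `ys`.
guarded⁻ : ∀ {m} (Q : NumericalPredicate m) {n} {top : Fin n} {ys} → suc (toℕ top) ≡ n →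
  unvaried (Guarded Q) n (top ∷ ys) → Q n ys
guarded⁻ Q last (n′ , eq , zs , zs≡ys , _ , q) with trans (sym eq) last
... | refl = subst (Q n′) (map-toℕ-injective zs≡ys) q

-- An atom in mid-translation: `m` arguments are already large, `k` are still original. `keep` and
-- `shift` move one argument across, recording in the relation itself how to decode it.
Relation : ℕ → ℕ → Set₁
Relation m k = ∀ n → Vec (Fin n) m → Vec (Fin n) k → Set

keep : ∀ {m k} → Relation m (suc k) → Relation (suc m) k
keep R n (y ∷ ys) xs = R n ys (y ∷ xs)

shift : ∀ {m k} → Relation m (suc k) → Relation (suc m) k
shift R n (y ∷ ys) xs = ∃ λ x → MSB₀ (toℕ y ∷ toℕ x ∷ []) × R n ys (x ∷ xs)

map-lookup-suc : ∀ {n v m} (i : Fin n) (ρ : Vec (Fin n) v) (xs : Vec (Fin v) m) →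
  map (lookup (i ∷ ρ)) (map suc xs) ≡ map (lookup ρ) xs
map-lookup-suc i ρ xs = sym (map-∘ (lookup (i ∷ ρ)) suc xs)

module _ {A : Set} where

  -- The entries ys have been replaced by large elements, the entries xs have not.
  enlarge : ∀ {v m k} → Relation m k → Fin v → Vec (Fin v) m → Vec (Fin v) k → FO ≤-MSB₀-fin A v
  enlarge R top ys [] =
    num _ (fin⊆ (finiteDegree (guarded-finiteDegree (λ n zs → R n zs [])))) (top ∷ ys)
  enlarge R top ys (x ∷ xs) =
    enlarge (keep R) top (x ∷ ys) xs ∨′
    ∃′ (num _ msb₀ (zero ∷ suc x ∷ []) ∧′
        enlarge (shift R) (suc top) (zero ∷ map suc ys) (map suc xs))

  enlarge-sound : ∀ {v m k} (R : Relation m k) {top : Fin v} {ys} xs (u : List A) {ρ} →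
    suc (toℕ (lookup ρ top)) ≡ length u → u , ρ ⊨ enlarge R top ys xs →
    R (length u) (map (lookup ρ) ys) (map (lookup ρ) xs)
  enlarge-sound R []       u last p = guarded⁻ (λ n zs → R n zs []) last p
  enlarge-sound R (x ∷ xs) u last (inj₁ p) = enlarge-sound (keep R) xs u last p
  enlarge-sound R {ys = ys} (x ∷ xs) u {ρ} last (inj₂ (i , msb , p))
    with enlarge-sound (shift R) (map suc xs) u last p
  -- `MSB₀` is functional, so the decoded `x′` is the value of the variable `x`.
  ... | x′ , msb′ , r = subst₂ (R _) (map-lookup-suc i ρ ys)
    (cong₂ _∷_ (toℕ-injective (trans (proj₂ msb′) (sym (proj₂ msb)))) (map-lookup-suc i ρ xs)) r

  -- `large-or-MSB₀` picks the disjunct for each entry; largeness of the replacements is carried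
  -- along until the guard of the final atom demands it.
  enlarge-complete : ∀ {v m k} (R : Relation m k) {top : Fin v} {ys} xs (u : List A) {ρ} →
    suc (toℕ (lookup ρ top)) ≡ length u → All (Large (length u)) (map toℕ (map (lookup ρ) ys)) →
    R (length u) (map (lookup ρ) ys) (map (lookup ρ) xs) → u , ρ ⊨ enlarge R top ys xs
  enlarge-complete R []       u last large r = _ , last , _ , refl , large , r
  enlarge-complete R {ys = ys} (x ∷ xs) u {ρ} last large r with large-or-MSB₀ (lookup ρ x)
  ... | inj₁ l = inj₁ (enlarge-complete (keep R) xs u last (l ∷ large) r)
  ... | inj₂ (i , l , msb) = inj₂ (i , msb , enlarge-complete (shift R) (map suc xs) u last
    (l ∷ subst (All _ ∘ map toℕ) (sym (map-lookup-suc i ρ ys)) large)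
    (lookup ρ x , msb , subst₂ (R _) (sym (map-lookup-suc i ρ ys))
                          (cong (lookup ρ x ∷_) (sym (map-lookup-suc i ρ xs))) r))

-- The empty universe has no greatest element to guard with, so the truth value of `P` there is
-- frozen into a nullary predicate, which has finite degree because no number occurs in the empty
-- tuple.
AtEmpty : ∀ {k} → NumericalPredicate k → Pred (Vec ℕ 0) 0ℓ
AtEmpty {k} P _ = ∃ λ (xs : Vec (Fin 0) k) → P 0 xs

atEmpty-finiteDegree : ∀ {k} (P : NumericalPredicate k) → FiniteDegree (AtEmpty P)
atEmpty-finiteDegree P a = [] , λ _ _ ()

Vec-Fin0-irrelevant : ∀ {k} (xs ys : Vec (Fin 0) k) → xs ≡ ys
Vec-Fin0-irrelevant []       [] = refl
Vec-Fin0-irrelevant (() ∷ _)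

greatest : ∀ {n} (top : Fin n) → (∀ (z : Fin n) → toℕ z ≤ toℕ top) → suc (toℕ top) ≡ n
greatest {suc n} top max =
  cong suc (≤-antisym (toℕ≤pred[n] top) (subst (_≤ toℕ top) (toℕ-fromℕ n) (max (fromℕ n))))

-- The second disjunct matters only for 0-ary P: otherwise a valuation of the
-- arguments makes the universe non-empty.
by-universe-size : ∀ {k} (P : NumericalPredicate k) n {xs : Vec (Fin n) k} {T : Fin n → Set} →
  (∀ top → suc (toℕ top) ≡ n → P n xs ⇔ T top) →
  P n xs ⇔ ((∃ λ top → (∀ (z : Fin n) → toℕ z ≤ toℕ top) × T top) ⊎
            (¬ (∃ λ (z : Fin n) → z ≡ z) × AtEmpty P []))
by-universe-size P zero {xs} _ = mk⇔
  (λ p → inj₂ ((λ ()) , xs , p))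
  λ { (inj₁ (() , _)) ; (inj₂ (_ , ys , p)) → subst (P 0) (Vec-Fin0-irrelevant ys xs) p }
by-universe-size P (suc n) P⇔T = mk⇔
  (λ p → inj₁ (fromℕ n
             , (λ z → subst (toℕ z ≤_) (sym (toℕ-fromℕ n)) (toℕ≤pred[n] z))
             , to (P⇔T (fromℕ n) (cong suc (toℕ-fromℕ n))) p))
  λ { (inj₁ (top , max , t)) → from (P⇔T top (greatest top max)) t
    ; (inj₂ (empty , _))     → contradiction (zero , refl) empty }

Expressible : ∀ 𝒩 {A v} → (∀ (u : List A) → Vec (Fin (length u)) v → Set) → Set₁
Expressible 𝒩 {A} {v} D = ∃ λ (φ : FO 𝒩 A v) → ∀ u ρ → D u ρ ⇔ (u , ρ ⊨ φ)

arb-expressible : ∀ {A k v} (P : NumericalPredicate k) (xs : Vec (Fin v) k) →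
  Expressible ≤-MSB₀-fin {A} (λ u ρ → P (length u) (map (lookup ρ) xs))
arb-expressible {A} {k} P xs = φ , λ u ρ → by-universe-size P (length u) λ top last →
    subst (λ ys → P (length u) ys ⇔ (u , top ∷ ρ ⊨ enlarge R zero [] (map suc xs))) (map-lookup-suc top ρ xs)
      (mk⇔ (enlarge-complete R {zero} (map suc xs) u {top ∷ ρ} last []) (enlarge-sound R (map suc xs) u last))
  where
  R : Relation 0 k
  R n _ = P n
  φ : FO ≤-MSB₀-fin A _
  -- The semantics of `φ` unfolds to the right-hand side of `by-universe-size`. Under `∀′`,
  -- `suc zero` is the candidate for the greatest position.
  φ = ∃′ ((∀′ num _ leq (zero ∷ suc zero ∷ [])) ∧′ enlarge R zero [] (map suc xs))
      ∨′ ((¬′ ∃′ (zero ≈′ zero)) ∧′ num _ (fin⊆ (finiteDegree (atEmpty-finiteDegree P))) [])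

AtomsExpressible : NumericalClass → NumericalClass → Set → Set₁
AtomsExpressible 𝒩 ℳ A = ∀ {k v} (P : NumericalPredicate k) → 𝒩 k P → (xs : Vec (Fin v) k) →
  Expressible ℳ {A} (λ u ρ → P (length u) (map (lookup ρ) xs))

-- The two logics differ only in their numerical atoms, and equivalence is a congruence for all
-- connectives and quantifiers.
translate : ∀ {𝒩 ℳ A} →
  AtomsExpressible 𝒩 ℳ A →
  ∀ {v} (φ : FO 𝒩 A v) → Expressible ℳ (λ u ρ → u , ρ ⊨ φ)
translate atom (letter a x) = letter a x , λ u ρ → ⇔-id _
translate atom (num P p xs) = atom P p xs
translate atom (x ≈′ y)     = x ≈′ y , λ u ρ → ⇔-id _
translate atom (¬′ φ) with translate atom φ
... | φ′ , e = ¬′ φ′ , λ u ρ → ¬-cong-⇔ (e u ρ)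
translate atom (φ ∧′ ψ) with translate atom φ | translate atom ψ
... | φ′ , e | ψ′ , f = φ′ ∧′ ψ′ , λ u ρ → e u ρ ×-⇔ f u ρ
translate atom (φ ∨′ ψ) with translate atom φ | translate atom ψ
... | φ′ , e | ψ′ , f = φ′ ∨′ ψ′ , λ u ρ → e u ρ ⊎-⇔ f u ρ
translate atom (φ ⇒′ ψ) with translate atom φ | translate atom ψ
... | φ′ , e | ψ′ , f = φ′ ⇒′ ψ′ , λ u ρ → →-cong-⇔ (e u ρ) (f u ρ)
translate atom (∃′ φ) with translate atom φ
... | φ′ , e = ∃′ φ′ , λ u ρ → Σ-⇔ (↠-id _) (e u (_ ∷ ρ))
translate atom (∀′ φ) with translate atom φ
... | φ′ , e = ∀′ φ′ , λ u ρ → mk⇔ (λ p i → to (e u (i ∷ ρ)) (p i)) (λ p i → from (e u (i ∷ ρ)) (p i))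

definable-mono : ∀ {𝒩 ℳ A} →
  AtomsExpressible 𝒩 ℳ A →
  (L : Language A) → DefinableIn 𝒩 L → DefinableIn ℳ L
definable-mono atom L (φ , L⊆φ , φ⊆L) with translate atom φ
... | φ′ , e = φ′ , (λ {u} l → to (e u []) (L⊆φ l)) , (λ {u} p → φ⊆L (from (e u []) p))

theorem1 : (A : Set) (s : ℕ) → A ↔ Fin s →
    (L : Language A) → DefinableIn arb L ⇔ DefinableIn ≤-MSB₀-fin L
theorem1 A s _ L = mk⇔
  (definable-mono (λ P _ → arb-expressible P) L)
  -- Every numerical predicate is in `arb`, so each atom translates to itself.
  (definable-mono (λ P _ xs → num P tt xs , λ u ρ → ⇔-id _) L)
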